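{- Let $G$ be an $r$-regular graph on $m$ vertices with $r\ge 1$ (i.e. $G$ has at least one edge). (a) If $n\ge 2$ is even, then $K_n\boxtimes G$ is $\mathbb{Z}_{nm}$-distance antimagic. (b) If $n\ge 3$ and $m$ are both odd, then $K_n\boxtimes G$ is $\mathbb{Z}_{nm}$-distance antimagic.
   Context: $K_n$ is the complete graph on $n$ vertices. The strong product $G_1\boxtimes G_2$ has vertex set $V(G_1)\times V(G_2)$, with distinct $(x_1,x_2),(y_1,y_2)$ adjacent iff for each $i$ either $x_i=y_i$ or $x_iy_i\in E(G_i)$. For a graph $H$ with $N$ vertices, a $\mathbb{Z}_N$-distance antimagic labelling is a bijection $f:V(H)\to\mathbb{Z}_N$ such that the weights $w_f(x)=\sum_{y\in N(x)} f(y)$ (mod $N$, $N(x)$ the open neighbourhood) are pairwise distinct; $H$ is $\mathbb{Z}_N$-distance antimagic if such a labelling exists. -}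

module Defs where

open import Data.Fin using (Fin; toℕ)
import Data.Fin.Properties as Fin
open import Data.List using (List; length; map; filter; tabulate)
open import Data.Nat using (ℕ; _*_)
open import Data.Nat.DivMod using (_mod_)
open import Data.Nat.ListAction using (sum)
open import Data.Product using (Σ-syntax; _×_; _,_; proj₁; proj₂)
open import Data.Product.Function.NonDependent.Propositional using (_×-↔_)
open import Data.Product.Properties using (≡-dec)
open import Data.Sum using (_⊎_)
import Data.Sum as Sum
open import Function using (_∘_; _↔_; _⤖_; Inverse; Bijection)
open import Function.Properties.Inverse using (↔⇒↣; ↔-refl; ↔-sym; ↔-trans)
open import Relation.Binary using (Rel; Decidable; DecidableEquality; Irreflexive; Symmetric)
open import Relation.Binary.PropositionalEquality using (_≡_; _≢_; sym; ≢-sym)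
open import Relation.Nullary using (¬?)
open import Relation.Nullary.Decidable using (via-injection; _×-dec_; _⊎-dec_)
open import Level using (0ℓ)

-- Finite simple graphs on N vertices.  Adjacency is decidable, so that
-- neighbourhoods can be enumerated; the enumeration `enum` serves only to say
-- that there are exactly N vertices and to sum over them.
record Graph (N : ℕ) : Set₁ where
  field
    V        : Set
    enum     : V ↔ Fin N
    E        : Rel V 0ℓ
    E?       : Decidable E
    E-sym    : Symmetric E
    E-irrefl : Irreflexive _≡_ E

  _≟V_ : DecidableEquality V
  _≟V_ = via-injection (↔⇒↣ enum) Fin._≟_

  vertices : List V
  vertices = tabulate (Inverse.from enum)

  neighbours : V → List V
  neighbours x = filter (E? x) vertices

  degree : V → ℕ
  degree x = length (neighbours x)

open Graph

Regular : ∀ {N} → ℕ → Graph N → Set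
Regular r G = ∀ x → degree G x ≡ r

K : ∀ n → Graph n
K n = record
  { V        = Fin n
  ; enum     = ↔-refl
  ; E        = _≢_
  ; E?       = λ x y → ¬? (x Fin.≟ y)
  ; E-sym    = ≢-sym
  ; E-irrefl = λ x≡y x≢y → x≢y x≡y
  }

infixr 7 _⊠_

_⊠_ : ∀ {n m} → Graph n → Graph m → Graph (n * m)
G₁ ⊠ G₂ = record
  { V        = V G₁ × V G₂
  ; enum     = ↔-trans (enum G₁ ×-↔ enum G₂) (↔-sym Fin.*↔×)
  ; E        = λ x y → x ≢ y
                     × (proj₁ x ≡ proj₁ y ⊎ E G₁ (proj₁ x) (proj₁ y))
                     × (proj₂ x ≡ proj₂ y ⊎ E G₂ (proj₂ x) (proj₂ y))
  ; E?       = λ { (x₁ , x₂) (y₁ , y₂) →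
                     ¬? (≡-dec (_≟V_ G₁) (_≟V_ G₂) (x₁ , x₂) (y₁ , y₂))
                     ×-dec ((_≟V_ G₁ x₁ y₁ ⊎-dec E? G₁ x₁ y₁)
                     ×-dec (_≟V_ G₂ x₂ y₂ ⊎-dec E? G₂ x₂ y₂)) }
  ; E-sym    = λ { (x≢y , e₁ , e₂) →
                     ≢-sym x≢y , Sum.map sym (E-sym G₁) e₁ , Sum.map sym (E-sym G₂) e₂ }
  ; E-irrefl = λ { x≡y (x≢y , _) → x≢y x≡y }
  }

-- ℤ_N is represented by the residues Fin N.  A labelled vertex shows that
-- N is nonzero, so reduction mod N makes sense.
weight : ∀ {N} (H : Graph N) → (V H → Fin N) → V H → Fin N
weight {N} H f x = _mod_ (sum (map (toℕ ∘ f) (neighbours H x))) N {{Fin.nonZeroIndex (f x)}}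

IsDistanceAntimagicLabelling : ∀ {N} (H : Graph N) → V H ⤖ Fin N → Set
IsDistanceAntimagicLabelling H f = ∀ x y → x ≢ y → weight H to x ≢ weight H to y
  where open Bijection f using (to)

-- For a graph with N vertices this is ℤ_N-distance antimagic.
DistanceAntimagic : ∀ {N} → Graph N → Set
DistanceAntimagic {N} H = Σ[ f ∈ (V H ⤖ Fin N) ] IsDistanceAntimagicLabelling H f

-- Suppose the labelling f of K n ⊠ G has the same sum c over every column
-- {(i , v) | i ∈ K n}.  The closed neighbourhood of (i , v) is the union of the
-- r + 1 columns over the closed neighbourhood of v, so the weight of (i , v) is
-- (r + 1) c − f (i , v), and the weights are distinct because the labels are.
-- Such an f is obtained as m i + pᵢ(v) for permutations pᵢ of {0, …, m − 1}
-- whose sum is constant (a Kotzig array): u and m − 1 − u are two such rows, and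
-- for m odd there are also three.
module Submission where

open import Defs
open import Data.Bool using (true; false; if_then_else_)
open import Data.Fin using (Fin; zero; suc; toℕ; fromℕ<; combine; remQuot; opposite; punchIn; _↑ˡ_; _↑ʳ_)
import Data.Fin.Properties as Fin
open import Data.Fin.Patterns using (0F; 1F; 2F)
open import Data.Fin.Permutation using (Permutation′; _⟨$⟩ʳ_; id; reverse; lift₀; insert; insert-punchIn; cast-id; _∘ₚ_)
open import Data.List using (List; []; _∷_; length; map; filter; tabulate)
open import Data.Nat using (ℕ; zero; suc; pred; _+_; _*_; _≤_; _<_; s≤s; NonZero)
open import Data.Nat.DivMod
open import Data.Nat.Divisibility using (_∣_; _∤_; divides; m%n≡0⇒n∣m)
open import Data.Nat.ListAction using () renaming (sum to sumˡ)
open import Data.Nat.Properties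
open import Data.Nat.Tactic.RingSolver using (solve)
open import Data.Product using (_×_; ∃-syntax; _,_; proj₂; uncurry)
open import Data.Product.Algebra using (×-comm)
open import Data.Product.Function.NonDependent.Propositional using (_×-↔_)
open import Data.Sum using (_⊎_; inj₁; inj₂)
open import Function using (_∘_; const; _↔_; mk↔ₛ′; Inverse)
open import Function.Properties.Inverse using (↔-refl; ↔-sym; ↔-trans; ↔⇒⤖)
open import Level using (Level)
open import Relation.Binary using (DecidableEquality)
open import Relation.Binary.PropositionalEquality
open import Relation.Nullary using (¬_; Dec; does; yes; no; contradiction)
open import Relation.Nullary.Decidable using (_⊎-dec_)
open import Relation.Unary using (Decidable; Pred)

open import Algebra.Properties.Semiring.Sum +-*-semiring
open Graph
open ≡-Reasoning

private
  variable
    a p : Level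
    A P Q : Set a
    m n : ℕ

-- Indicators and finite sums

indicator : Dec P → ℕ
indicator P? = if does P? then 1 else 0

indicator-⇔ : (P? : Dec P) (Q? : Dec Q) → (P → Q) → (Q → P) → indicator P? ≡ indicator Q?
indicator-⇔ (yes _)  (yes _)  _ _ = refl
indicator-⇔ (yes p)  (no ¬q)  f _ = contradiction (f p) ¬q
indicator-⇔ (no ¬p)  (yes q)  _ g = contradiction (g q) ¬p
indicator-⇔ (no _)   (no _)   _ _ = refl

indicator-⊎ : (P? : Dec P) (Q? : Dec Q) → ¬ (P × Q) →
              indicator (P? ⊎-dec Q?) ≡ indicator P? + indicator Q?
indicator-⊎ (yes p) (yes q) disjoint = contradiction (p , q) disjoint
indicator-⊎ (yes _) (no _)  _        = refl
indicator-⊎ (no _)  (yes _) _        = refl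
indicator-⊎ (no _)  (no _)  _        = refl

sum-filter-tabulate : {P : Pred A p} (P? : Decidable P) (g : A → ℕ) (h : Fin n → A) →
  sumˡ (map g (filter P? (tabulate h))) ≡ ∑[ k < n ] (indicator (P? (h k)) * g (h k))
sum-filter-tabulate {n = zero}  P? g h = refl
sum-filter-tabulate {n = suc n} P? g h with does (P? (h zero))
... | true  = cong₂ _+_ (sym (*-identityˡ (g (h zero)))) (sum-filter-tabulate P? g (h ∘ suc))
... | false = sum-filter-tabulate P? g (h ∘ suc)

length≡sum-1 : (xs : List A) → length xs ≡ sumˡ (map (const 1) xs)
length≡sum-1 []       = refl
length≡sum-1 (_ ∷ xs) = cong suc (length≡sum-1 xs)

∑-indicator-Fin : (t : Fin n → ℕ) (i : Fin n) → ∑[ k < n ] (indicator (i Fin.≟ k) * t k) ≡ t i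
∑-indicator-Fin {suc n} t zero = begin
  t zero + 0 + ∑[ k < n ] 0  ≡⟨ cong₂ _+_ (+-identityʳ (t zero)) (sum-replicate-zero n) ⟩
  t zero + 0                 ≡⟨ +-identityʳ (t zero) ⟩
  t zero                     ∎
∑-indicator-Fin {suc n} t (suc i) = ∑-indicator-Fin (t ∘ suc) i

-- An indicator depends only on the truth of its proposition, so the test `x ≡ from k` can be traded
-- for `to x ≡ k`, which reduces the claim to `Fin n`.
∑-indicator : (enum : A ↔ Fin n) (_≟A_ : DecidableEquality A) (g : A → ℕ) (x : A) →
  (let open Inverse enum) → ∑[ k < n ] (indicator (x ≟A from k) * g (from k)) ≡ g x
∑-indicator {n = n} enum _≟A_ g x = begin
  ∑[ k < n ] (indicator (x ≟A from k) * g (from k))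
    ≡⟨ sum-cong-≗ (λ k → cong (_* g (from k)) (indicator-⇔ (x ≟A from k) (to x Fin.≟ k) inverseˡ (sym ∘ inverseʳ ∘ sym))) ⟩
  ∑[ k < n ] (indicator (to x Fin.≟ k) * g (from k))
    ≡⟨ ∑-indicator-Fin (g ∘ from) (to x) ⟩
  g (from (to x))
    ≡⟨ cong g (strictlyInverseʳ x) ⟩
  g x ∎
  where open Inverse enum

∑-+ : ∀ m (f : Fin (m + n) → ℕ) → sum f ≡ ∑[ i < m ] f (i ↑ˡ n) + ∑[ j < n ] f (m ↑ʳ j)
∑-+ zero    f = refl
∑-+ (suc m) f = trans (cong (f zero +_) (∑-+ m (f ∘ suc))) (sym (+-assoc (f zero) _ _))

∑-* : ∀ n m (f : Fin (n * m) → ℕ) → sum f ≡ ∑[ i < n ] ∑[ j < m ] f (combine i j)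
∑-* zero    m f = refl
∑-* (suc n) m f = trans (∑-+ m f) (cong (∑[ j < m ] f (j ↑ˡ n * m) +_) (∑-* n m (f ∘ (m ↑ʳ_))))

-- Weights in K n ⊠ G

module _ {m} (G : Graph m) where

  private
    uᴳ : Fin m → V G
    uᴳ = Inverse.from (enum G)

  closed? : ∀ v u → Dec (v ≡ u ⊎ E G v u)
  closed? v u = _≟V_ G v u ⊎-dec E? G v u

  indicator-closed : ∀ v u → indicator (closed? v u) ≡ indicator (E? G v u) + indicator (_≟V_ G v u)
  indicator-closed v u = trans
    (indicator-⊎ (_≟V_ G v u) (E? G v u) (λ (v≡u , e) → E-irrefl G v≡u e))
    (+-comm (indicator (_≟V_ G v u)) _)

  -- Adding `g x` closes the neighbourhood without any subtraction in ℕ. Irreflexivity makes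
  -- equality and adjacency exclusive, so their indicators add up to that of the closed
  -- neighbourhood.
  sum-neighbours : ∀ (g : V G → ℕ) x →
    sumˡ (map g (neighbours G x)) + g x ≡ ∑[ k < m ] (indicator (closed? x (uᴳ k)) * g (uᴳ k))
  sum-neighbours g x = begin
    sumˡ (map g (neighbours G x)) + g x
      ≡⟨ cong₂ _+_ (sum-filter-tabulate (E? G x) g uᴳ) (sym (∑-indicator (enum G) (_≟V_ G) g x)) ⟩
    ∑[ k < m ] (adjacent k * g (uᴳ k)) + ∑[ k < m ] (equal k * g (uᴳ k))
      ≡⟨ ∑-distrib-+ (λ k → adjacent k * g (uᴳ k)) (λ k → equal k * g (uᴳ k)) ⟨
    ∑[ k < m ] (adjacent k * g (uᴳ k) + equal k * g (uᴳ k))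
      ≡⟨ sum-cong-≗ (λ k → *-distribʳ-+ (g (uᴳ k)) (adjacent k) (equal k)) ⟨
    ∑[ k < m ] ((adjacent k + equal k) * g (uᴳ k))
      ≡⟨ sum-cong-≗ (λ k → cong (_* g (uᴳ k)) (indicator-closed x (uᴳ k))) ⟨
    ∑[ k < m ] (indicator (closed? x (uᴳ k)) * g (uᴳ k)) ∎
    where
    adjacent equal : Fin m → ℕ
    adjacent k = indicator (E? G x (uᴳ k))
    equal    k = indicator (_≟V_ G x (uᴳ k))

  -- This is `sum-neighbours` for the constant function 1.
  ∑-closed : ∀ x → ∑[ k < m ] indicator (closed? x (uᴳ k)) ≡ suc (degree G x)
  ∑-closed x = begin
    ∑[ k < m ] indicator (closed? x (uᴳ k))        ≡⟨ sum-cong-≗ (λ k → *-identityʳ (indicator (closed? x (uᴳ k)))) ⟨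
    ∑[ k < m ] (indicator (closed? x (uᴳ k)) * 1)  ≡⟨ sum-neighbours (const 1) x ⟨
    sumˡ (map (const 1) (neighbours G x)) + 1      ≡⟨ cong (_+ 1) (length≡sum-1 (neighbours G x)) ⟨
    degree G x + 1                                 ≡⟨ +-comm (degree G x) 1 ⟩
    suc (degree G x)                               ∎

module _ {m n} (G : Graph m) (g : V (K n ⊠ G) → ℕ) (c : ℕ) (columnSum : ∀ u → ∑[ i < n ] g (i , u) ≡ c) where

  private
    H = K n ⊠ G
    uᴳ : Fin m → V G
    uᴳ = Inverse.from (enum G)
    uᴴ : Fin (n * m) → V H
    uᴴ = Inverse.from (enum H)

  -- Any two vertices of `K n` are equal or adjacent, so the first coordinate imposes no condition:
  -- closed neighbourhoods are unions of whole columns.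
  indicator-closed-⊠ : ∀ x y → indicator (closed? H x y) ≡ indicator (closed? G (proj₂ x) (proj₂ y))
  indicator-closed-⊠ x@(i , v) y@(j , u) = indicator-⇔ (closed? H x y) (closed? G v u) project lift
    where
    project : x ≡ y ⊎ E H x y → v ≡ u ⊎ E G v u
    project (inj₁ x≡y)         = inj₁ (cong proj₂ x≡y)
    project (inj₂ (_ , _ , e)) = e
    lift : v ≡ u ⊎ E G v u → x ≡ y ⊎ E H x y
    -- Adjacency in `H` demands distinct pairs, so equality of the pairs is settled before the
    -- coordinates are compared.
    lift e with _≟V_ H x y | i Fin.≟ j
    ... | yes x≡y | _       = inj₁ x≡y
    ... | no  x≢y | yes i≡j = inj₂ (x≢y , inj₁ i≡j , e)
    ... | no  x≢y | no  i≢j = inj₂ (x≢y , inj₂ i≢j , e)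

  sum-neighbours-⊠ : ∀ x → sumˡ (map g (neighbours H x)) + g x ≡ suc (degree G (proj₂ x)) * c
  sum-neighbours-⊠ x@(_ , v) = begin
    sumˡ (map g (neighbours H x)) + g x
      ≡⟨ sum-neighbours H g x ⟩
    ∑[ k < n * m ] (indicator (closed? H x (uᴴ k)) * g (uᴴ k))
      ≡⟨ sum-cong-≗ (λ k → cong (_* g (uᴴ k)) (indicator-closed-⊠ x (uᴴ k))) ⟩
    ∑[ k < n * m ] term (uᴴ k)
      ≡⟨ ∑-* n m (term ∘ uᴴ) ⟩
    ∑[ i < n ] ∑[ j < m ] term (uᴴ (combine i j))
      -- The enumeration of `H` decodes the index `combine i j` to `(i , uᴳ j)`.
      ≡⟨ sum-cong-≗ (λ i → sum-cong-≗ (λ j → cong (λ (i , j) → term (i , uᴳ j)) (Fin.remQuot-combine i j))) ⟩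
    ∑[ i < n ] ∑[ j < m ] term (i , uᴳ j)
      -- Summing down each column first lets the indicator, which ignores `i`, factor out.
      ≡⟨ ∑-comm (λ i j → term (i , uᴳ j)) ⟩
    ∑[ j < m ] ∑[ i < n ] term (i , uᴳ j)
      ≡⟨ sum-cong-≗ (λ j → *-distribˡ-sum (indicator (closed? G v (uᴳ j))) (λ i → g (i , uᴳ j))) ⟨
    ∑[ j < m ] (indicator (closed? G v (uᴳ j)) * ∑[ i < n ] g (i , uᴳ j))
      ≡⟨ sum-cong-≗ (λ j → cong (indicator (closed? G v (uᴳ j)) *_) (columnSum (uᴳ j))) ⟩
    ∑[ j < m ] (indicator (closed? G v (uᴳ j)) * c)
      ≡⟨ *-distribʳ-sum c (λ j → indicator (closed? G v (uᴳ j))) ⟨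
    ∑[ j < m ] indicator (closed? G v (uᴳ j)) * c
      ≡⟨ cong (_* c) (∑-closed G v) ⟩
    suc (degree G v) * c ∎
    where
    term : V H → ℕ
    term y = indicator (closed? G v (proj₂ y)) * g y

-- Subtracting the common residue from both sides of `s + x ≡ t + y` leaves `x` and `y` plus
-- multiples of `N`. Hence they are congruent mod `N`, and both lie below `N`.
%-cancel : ∀ {N s t x y} .{{_ : NonZero N}} → x < N → y < N →
           s % N ≡ t % N → s + x ≡ t + y → x ≡ y
%-cancel {N} {s} {t} {x} {y} x<N y<N s%N≡t%N s+x≡t+y = begin
  x                    ≡⟨ m<n⇒m%n≡m x<N ⟨
  x % N                ≡⟨ [m+kn]%n≡m%n x (s / N) N ⟨
  (x + s / N * N) % N  ≡⟨ cong (_% N) (+-cancelˡ-≡ (s % N) _ _ shifted) ⟩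
  (y + t / N * N) % N  ≡⟨ [m+kn]%n≡m%n y (t / N) N ⟩
  y % N                ≡⟨ m<n⇒m%n≡m y<N ⟩
  y                    ∎
  where
  regroup : ∀ s x → s % N + (x + s / N * N) ≡ s + x
  regroup s x = begin
    s % N + (x + s / N * N)  ≡⟨ cong (s % N +_) (+-comm x _) ⟩
    s % N + (s / N * N + x)  ≡⟨ +-assoc (s % N) _ x ⟨
    s % N + s / N * N + x    ≡⟨ cong (_+ x) (m≡m%n+[m/n]*n s N) ⟨
    s + x                    ∎
  shifted : s % N + (x + s / N * N) ≡ s % N + (y + t / N * N)
  shifted = begin
    s % N + (x + s / N * N)  ≡⟨ regroup s x ⟩
    s + x                    ≡⟨ s+x≡t+y ⟩
    t + y                    ≡⟨ regroup t y ⟨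
    t % N + (y + t / N * N)  ≡⟨ cong (_+ (y + t / N * N)) s%N≡t%N ⟨
    s % N + (y + t / N * N)  ∎

-- Kotzig arrays

-- For m ≥ 1, summing all entries in two ways forces 2 · `total` = n (m - 1). So n (m - 1) must be
-- even, which is where the parity conditions of the two cases come from.
record KotzigArray (n m : ℕ) : Set where
  field
    row       : Fin n → Permutation′ m
    total     : ℕ
    columnSum : ∀ u → ∑[ i < n ] toℕ (row i ⟨$⟩ʳ u) ≡ total

toℕ+toℕ-opposite : (i : Fin n) → toℕ i + toℕ (opposite i) ≡ pred n
toℕ+toℕ-opposite {suc n} i = trans
  (cong (toℕ i +_) (Fin.opposite-prop i))
  (m+[n∸m]≡n (Fin.toℕ≤pred[n] i))

empty : ∀ m → KotzigArray 0 m
empty m = record { row = λ () ; total = 0 ; columnSum = λ _ → refl }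

addTwoRows : KotzigArray n m → KotzigArray (2 + n) m
addTwoRows {n} {m} array = record
  { row       = row′
  ; total     = pred m + total
  ; columnSum = λ u → trans
      (sym (+-assoc (toℕ u) _ _))
      (cong₂ _+_ (toℕ+toℕ-opposite u) (columnSum u))
  }
  where
  open KotzigArray array
  row′ : Fin (2 + n) → Permutation′ m
  row′ zero          = id
  row′ (suc zero)    = reverse
  row′ (suc (suc i)) = row i

addRows : ∀ q → KotzigArray n m → KotzigArray (q * 2 + n) m
addRows zero    array = array
addRows (suc q) array = addTwoRows (addRows q array)

-- Three rows for m = 2k + 1

toℕ-punchIn-< : (i : Fin (suc n)) (j : Fin n) → toℕ j < toℕ i → toℕ (punchIn i j) ≡ toℕ j
toℕ-punchIn-< (suc i) zero    _         = refl
toℕ-punchIn-< (suc i) (suc j) (s≤s j<i) = cong suc (toℕ-punchIn-< i j j<i)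

toℕ-punchIn-≥ : (i : Fin (suc n)) (j : Fin n) → toℕ i ≤ toℕ j → toℕ (punchIn i j) ≡ suc (toℕ j)
toℕ-punchIn-≥ zero    j       _         = refl
toℕ-punchIn-≥ (suc i) (suc j) (s≤s i≤j) = cong suc (toℕ-punchIn-≥ i j i≤j)

module _ (k : ℕ) where

  middle : Fin (suc (2 * k))
  middle = fromℕ< (s≤s (m≤m+n k (k + 0)))

  toℕ-middle : toℕ middle ≡ k
  toℕ-middle = Fin.toℕ-fromℕ< (s≤s (m≤m+n k (k + 0)))

  -- The cyclic shift by k: an index k d + c is read as half `d` and offset `c`, and the two halves
  -- are exchanged.
  swapHalves : Permutation′ (2 * k)
  swapHalves = ↔-trans (Fin.*↔× {2} {k}) (↔-trans (reverse ×-↔ ↔-refl) (↔-sym Fin.*↔×))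

  toℕ-swapHalves : (d : Fin 2) (c : Fin k) → toℕ (swapHalves ⟨$⟩ʳ combine d c) ≡ k * toℕ (opposite d) + toℕ c
  toℕ-swapHalves d c = trans
    (cong (λ ((d , c) : Fin 2 × Fin k) → toℕ (combine (opposite d) c)) (Fin.remQuot-combine d c))
    (Fin.toℕ-combine (opposite d) c)

  -- The perfect shuffle k d + c ↦ 2 c + d: the first half goes to the even places, the second to
  -- the odd ones. The cast turns k * 2 back into 2 * k.
  interleave : Permutation′ (2 * k)
  interleave = ↔-trans (Fin.*↔× {2} {k}) (↔-trans (×-comm _ _)
    (↔-trans (↔-sym (Fin.*↔× {k} {2})) (cast-id (*-comm k 2))))

  toℕ-interleave : (d : Fin 2) (c : Fin k) → toℕ (interleave ⟨$⟩ʳ combine d c) ≡ 2 * toℕ c + toℕ d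
  toℕ-interleave d c = trans (Fin.toℕ-cast (*-comm k 2) (combine {k} {2} _ _)) (trans
    (cong (λ ((d , c) : Fin 2 × Fin k) → toℕ (combine c d)) (Fin.remQuot-combine d c))
    (Fin.toℕ-combine c d))

  -- Put a = b / 2 for b even and a = k + (b + 1) / 2 for b odd.  As b runs
  -- through 0, …, 2k, so do a and k + b − a.  The columns (a , k + b − a , b) are
  -- listed with k + b − a in the order k, 0, …, k − 1, k + 1, …, 2k.
  shiftedHalves middleFirst doubled : Permutation′ (suc (2 * k))
  shiftedHalves = lift₀ swapHalves
  middleFirst   = insert 0F middle id
  doubled       = lift₀ interleave

  -- This is a + (k + b - a) = k + b. Column 0 reads (0, k, 0); at the index 1 + k d + c the entries
  -- are 1 + k (1 - d) + c, (k + 1) d + c and 1 + 2 c + d.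
  shiftedHalves+middleFirst : ∀ u →
    toℕ (shiftedHalves ⟨$⟩ʳ u) + toℕ (middleFirst ⟨$⟩ʳ u) ≡ k + toℕ (doubled ⟨$⟩ʳ u)
  shiftedHalves+middleFirst zero    = trans toℕ-middle (sym (+-identityʳ k))
  shiftedHalves+middleFirst (suc v) = subst Column (Fin.combine-remQuot {2} k v) (uncurry column (remQuot {2} k v))
    where
    Column : Fin (2 * k) → Set
    Column v = toℕ (shiftedHalves ⟨$⟩ʳ suc v) + toℕ (middleFirst ⟨$⟩ʳ suc v) ≡ k + toℕ (doubled ⟨$⟩ʳ suc v)

    toℕ-middleFirst : (d : Fin 2) (c : Fin k) → toℕ (middleFirst ⟨$⟩ʳ suc (combine d c)) ≡ suc k * toℕ d + toℕ c
    toℕ-middleFirst d c = trans (cong toℕ (insert-punchIn 0F middle id (combine d c))) (half d)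
      where
      -- The value k is already taken by column 0. The first half lies below it and stays put; the
      -- second half begins at k and moves up by one.
      half : (d : Fin 2) → toℕ (punchIn middle (combine d c)) ≡ suc k * toℕ d + toℕ c
      half 0F = begin
        toℕ (punchIn middle (combine {2} 0F c))
          ≡⟨ toℕ-punchIn-< middle _ (subst₂ _<_ (sym (Fin.toℕ-↑ˡ c (k + 0))) (sym toℕ-middle) (Fin.toℕ<n c)) ⟩
        toℕ (c ↑ˡ (k + 0))
          ≡⟨ Fin.toℕ-↑ˡ c (k + 0) ⟩
        toℕ c
          ≡⟨ cong (_+ toℕ c) (*-zeroʳ k) ⟨
        suc k * 0 + toℕ c ∎
      half 1F = begin
        toℕ (punchIn middle (combine {2} 1F c))
          ≡⟨ toℕ-punchIn-≥ middle _ (subst₂ _≤_ (sym toℕ-middle) (sym toℕ-combine-1) (m≤m+n k (toℕ c))) ⟩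
        suc (toℕ (combine {2} 1F c))
          ≡⟨ cong suc toℕ-combine-1 ⟩
        suc k + toℕ c
          ≡⟨ cong (_+ toℕ c) (*-identityʳ (suc k)) ⟨
        suc k * 1 + toℕ c ∎
        where
        toℕ-combine-1 : toℕ (combine {2} 1F c) ≡ k + toℕ c
        toℕ-combine-1 = trans (Fin.toℕ-combine {2} 1F c) (cong (_+ toℕ c) (*-identityʳ k))

    balance : ∀ k (d : Fin 2) c →
      suc (k * toℕ (opposite d) + c) + (suc k * toℕ d + c) ≡ k + suc (2 * c + toℕ d)
    balance k 0F c = solve (k ∷ c ∷ [])
    balance k 1F c = solve (k ∷ c ∷ [])

    column : (d : Fin 2) (c : Fin k) → Column (combine d c)
    column d c = begin
      suc (toℕ (swapHalves ⟨$⟩ʳ combine d c)) + toℕ (middleFirst ⟨$⟩ʳ suc (combine d c))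
        ≡⟨ cong₂ (λ x y → suc x + y) (toℕ-swapHalves d c) (toℕ-middleFirst d c) ⟩
      suc (k * toℕ (opposite d) + toℕ c) + (suc k * toℕ d + toℕ c)
        ≡⟨ balance k d (toℕ c) ⟩
      k + suc (2 * toℕ c + toℕ d)
        ≡⟨ cong (λ x → k + suc x) (toℕ-interleave d c) ⟨
      k + toℕ (doubled ⟨$⟩ʳ suc (combine d c)) ∎

  threeRows : KotzigArray 3 (suc (2 * k))
  threeRows = record
    { row       = row
    ; total     = k + 2 * k
    ; columnSum = columnSum
    }
    where
    row : Fin 3 → Permutation′ (suc (2 * k))
    row 0F = shiftedHalves
    row 1F = middleFirst
    -- The first two rows add up to k + b, so the third must be 2k - b for the sum to be constant.
    row 2F = doubled ∘ₚ reverse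

    columnSum : ∀ u → ∑[ i < 3 ] toℕ (row i ⟨$⟩ʳ u) ≡ k + 2 * k
    columnSum u = begin
      x + (y + (toℕ (opposite w) + 0))  ≡⟨ cong (λ z → x + (y + z)) (+-identityʳ _) ⟩
      x + (y + toℕ (opposite w))        ≡⟨ +-assoc x y _ ⟨
      x + y + toℕ (opposite w)          ≡⟨ cong (_+ toℕ (opposite w)) (shiftedHalves+middleFirst u) ⟩
      k + toℕ w + toℕ (opposite w)      ≡⟨ +-assoc k (toℕ w) _ ⟩
      k + (toℕ w + toℕ (opposite w))    ≡⟨ cong (k +_) (toℕ+toℕ-opposite w) ⟩
      k + 2 * k                         ∎
      where
      x = toℕ (shiftedHalves ⟨$⟩ʳ u)
      y = toℕ (middleFirst ⟨$⟩ʳ u)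
      w = doubled ⟨$⟩ʳ u

-- From Kotzig arrays to labellings

-- The bijection on the second factor may vary with the first coordinate, so that each copy of `G`
-- can use its own row of the array.
×-fibrewise : ∀ {b c} {B : Set b} {C : Set c} → (A → B ↔ C) → (A × B) ↔ (A × C)
×-fibrewise π = mk↔ₛ′
  (λ (i , x) → i , Inverse.to (π i) x)
  (λ (i , y) → i , Inverse.from (π i) y)
  (λ (i , y) → cong (i ,_) (Inverse.strictlyInverseˡ (π i) y))
  (λ (i , x) → cong (i ,_) (Inverse.strictlyInverseʳ (π i) x))

kotzig⇒antimagic : ∀ {m n r} (G : Graph m) → Regular r G → KotzigArray n m → DistanceAntimagic (K n ⊠ G)
kotzig⇒antimagic {m} {n} {r} G regular array = ↔⇒⤖ labelling , antimagic
  where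
  open KotzigArray array

  labelling : V (K n ⊠ G) ↔ Fin (n * m)
  -- The last map sends (i, p) to m i + p, so copy `i` of `G` receives the i-th block of m
  -- consecutive labels.
  labelling = ↔-trans (×-fibrewise (λ i → ↔-trans (enum G) (row i))) (↔-sym Fin.*↔×)

  open Inverse labelling using (to; strictlyInverseʳ)

  label : V (K n ⊠ G) → ℕ
  label = toℕ ∘ to

  -- Every column meets each block exactly once, so the block offsets contribute the same amount to
  -- all columns.
  c : ℕ
  c = ∑[ i < n ] (m * toℕ i) + total

  label-columnSum : ∀ v → ∑[ i < n ] label (i , v) ≡ c
  label-columnSum v = begin
    ∑[ i < n ] label (i , v)
      ≡⟨ sum-cong-≗ (λ i → Fin.toℕ-combine i (row i ⟨$⟩ʳ u)) ⟩
    ∑[ i < n ] (m * toℕ i + toℕ (row i ⟨$⟩ʳ u))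
      ≡⟨ ∑-distrib-+ (λ i → m * toℕ i) (λ i → toℕ (row i ⟨$⟩ʳ u)) ⟩
    ∑[ i < n ] (m * toℕ i) + ∑[ i < n ] toℕ (row i ⟨$⟩ʳ u)
      ≡⟨ cong (∑[ i < n ] (m * toℕ i) +_) (columnSum u) ⟩
    c ∎
    where u = Inverse.to (enum G) v

  neighbourSum : V (K n ⊠ G) → ℕ
  neighbourSum x = sumˡ (map label (neighbours (K n ⊠ G) x))

  neighbourSum+label : ∀ x → neighbourSum x + label x ≡ suc r * c
  neighbourSum+label x = trans
    (sum-neighbours-⊠ G label c label-columnSum x)
    (cong (λ d → suc d * c) (regular (proj₂ x)))

  antimagic : IsDistanceAntimagicLabelling (K n ⊠ G) (↔⇒⤖ labelling)
  antimagic x y x≢y wx≡wy = x≢y (begin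
    x                             ≡⟨ strictlyInverseʳ x ⟨
    Inverse.from labelling (to x) ≡⟨ cong (Inverse.from labelling) (Fin.toℕ-injective label-≡) ⟩
    Inverse.from labelling (to y) ≡⟨ strictlyInverseʳ y ⟩
    y                             ∎)
    where
    instance
      nonZero : NonZero (n * m)
      nonZero = Fin.nonZeroIndex (to x)

    label-≡ : label x ≡ label y
    label-≡ = %-cancel {s = neighbourSum x} {t = neighbourSum y}
      (Fin.toℕ<n (to x)) (Fin.toℕ<n (to y))
      -- A weight is `fromℕ<` of a remainder, so equal weights give equal remainders of the
      -- neighbour sums.
      (Fin.fromℕ<-injective _ _ _ _ wx≡wy)
      (trans (neighbourSum+label x) (sym (neighbourSum+label y)))

-- The two parity cases

odd⇒1+2* : ∀ n → 2 ∤ n → ∃[ k ] n ≡ suc (2 * k)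
odd⇒1+2* n 2∤n with n % 2 in n%2≡ | m%n<n n 2
... | 0           | _ = contradiction (m%n≡0⇒n∣m n 2 n%2≡) 2∤n
... | 1           | _ = n / 2 , (begin
  n                    ≡⟨ m≡m%n+[m/n]*n n 2 ⟩
  n % 2 + n / 2 * 2    ≡⟨ cong₂ _+_ n%2≡ (*-comm (n / 2) 2) ⟩
  suc (2 * (n / 2))    ∎)
... | suc (suc _) | s≤s (s≤s ())

mainTheorem18 : (m r : ℕ) (G : Graph m) → 1 ≤ m → 1 ≤ r → Regular r G →
    (∀ n → 2 ≤ n → 2 ∣ n → DistanceAntimagic (K n ⊠ G))
    × (∀ n → 3 ≤ n → 2 ∤ n → 2 ∤ m → DistanceAntimagic (K n ⊠ G))
mainTheorem18 m r G _ _ regular = even , odd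
  where
  even : ∀ n → 2 ≤ n → 2 ∣ n → DistanceAntimagic (K n ⊠ G)
  even n _ (divides q n≡q*2) = kotzig⇒antimagic G regular
    -- With n = 2q, the array consists of q complementary pairs of rows.
    (subst (λ n → KotzigArray n m) (trans (+-identityʳ (q * 2)) (sym n≡q*2)) (addRows q (empty m)))

  odd : ∀ n → 3 ≤ n → 2 ∤ n → 2 ∤ m → DistanceAntimagic (K n ⊠ G)
  odd n 3≤n 2∤n 2∤m with odd⇒1+2* n 2∤n | odd⇒1+2* m 2∤m
  -- The bound 3 ≤ n excludes n = 1. Otherwise n = 2 l + 3: three rows, followed by l complementary
  -- pairs.
  ... | zero  , refl | _        = contradiction 3≤n λ { (s≤s ()) }
  ... | suc l , refl | k , refl = kotzig⇒antimagic G regular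
    (subst (λ n → KotzigArray n m) l*2+3≡ (addRows l (threeRows k)))
    where
    l*2+3≡ : l * 2 + 3 ≡ suc (2 * suc l)
    l*2+3≡ = solve (l ∷ [])
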